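{- Let $K$ be a commutative ring with division by integers, and let $A=(a_{ij})$ be an $n\times n$ matrix over $K$. Then $$\det(A)=\frac{1}{n!}\sum_{\sigma\in S_n}(-1)^{\tau(\sigma)}\Big\{(-1)^n\gamma_\sigma^n+\sum_{k=1}^n\Big((-1)^{n-k}\sum_{1\le j_1<\cdots<j_k\le n}\Big(\gamma_\sigma+\sum_{s=1}^k a_{j_s\sigma(j_s)}\Big)^n\Big)\Big\},$$ where $\{\gamma_\sigma\}_{\sigma\in S_n}$ is a set of $n!$ free variables $\gamma_\sigma\in K$. In particular, for all $\gamma_\sigma=\gamma$, $$\det(A)=\frac{(-1)^{n-1}}{n!}\Big\{\sum_{l\in L_{n-1}^{(e)}}(\gamma+su(l))^n-\sum_{l\in L_{n-1}^{(o)}}(\gamma+su(l))^n+\sum_{l\in L_n^{(o)}}(\gamma+su(l))^n-\sum_{l\in L_n^{(e)}}(\gamma+su(l))^n\Big\},$$ and, for all $\gamma_\sigma=0$, $$\det(A)=\frac{(-1)^{n-1}}{n!}\Big\{\sum_{l\in L_{n-1}^{(e)}}su(l)^n-\sum_{l\in L_{n-1}^{(o)}}su(l)^n+\sum_{l\in L_n^{(o)}}su(l)^n-\sum_{l\in L_n^{(e)}}su(l)^n\Big\}.$$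
   Context: A ring is "with division by integers" if for every nonzero integer $m$ the map $x\mapsto mx$ is bijective on the ring; $\frac1m x$ denotes the inverse image of $x$. $S_n$ is the set of permutations of $\{1,\dots,n\}$, $\tau(\sigma)$ is the number of inversions of $\sigma$, and $S_n^{(e)}$, $S_n^{(o)}$ are the sets of even and odd permutations. The determinant is $\det(A)=\sum_{\sigma\in S_n}(-1)^{\tau(\sigma)}a_{1\sigma(1)}\cdots a_{n\sigma(n)}$. For $\sigma\in S_n$ and $1\le i_1<\dots<i_k\le n$, the sequence $l=(a_{i_1\sigma(i_1)},\dots,a_{i_k\sigma(i_k)})$ is a subdiagonal of length $k$ of the diagonal $(a_{1\sigma(1)},\dots,a_{n\sigma(n)})$; subdiagonals are identified by their positions $\{(i_1,\sigma(i_1)),\dots,(i_k,\sigma(i_k))\}$ in the matrix. $L_k^{(e)}$ (respectively $L_k^{(o)}$) is the set of all subdiagonals of length $k$ of diagonals with $\sigma\in S_n^{(e)}$ (respectively $\sigma\in S_n^{(o)}$). $su(l)=\sum_{s=1}^k a_{i_s\sigma(i_s)}$ is the sum of the elements of $l$. For $n=1$, $L_0^{(e)}$ consists of the empty subdiagonal, with $su=0$, and $L_0^{(o)}=\emptyset$.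
   Formalization: In the second and third formulas the factor (-1)^{n-1} is replaced by -1: the printed sign is false for odd n (for n=1 it gives det(A) = -a_{11}) and agrees with -1 for even n; the first formula is unchanged. -}

module Defs where

open import Algebra.Bundles using (CommutativeRing; Semiring)
open import Data.Fin.Base using (Fin)
import Data.Fin.Properties as Fin
open import Data.Integer.Base using (ℤ; +_; -[1+_]; NonZero)
open import Data.List.Base using (List; []; _∷_; _++_; map; foldr; filter; length; concatMap; deduplicate; allFin; upTo; cartesianProduct; cartesianProductWith)
import Data.List.Properties as List
open import Data.Nat.Base using (ℕ; zero; suc; parity; _!)
open import Data.Nat.Properties using (_!≢0)
open import Data.Parity.Base using (Parity; 0ℙ; 1ℙ)
import Data.Parity.Properties as Parity
open import Data.Product.Base using (_×_; _,_; proj₁; proj₂)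
import Data.Product.Properties as Product
open import Data.Vec.Base using (Vec; []; _∷_; lookup)
open import Data.Vec.Relation.Unary.AllPairs using (allPairs?)
open import Function.Definitions using (Bijective)
open import Relation.Binary.Definitions using (DecidableEquality)
open import Relation.Nullary.Decidable using (¬?; _×-dec_)

------------------------------------------------------------------------
-- Permutations

words : ∀ {a} {A : Set a} → List A → ∀ m → List (Vec A m)
words xs zero    = [] ∷ []
words xs (suc m) = cartesianProductWith _∷_ xs (words xs m)

-- A permutation σ is represented by its one-line notation
-- (σ(1), …, σ(n)): a word of length n in Fin n without repetitions.

OneLine : ℕ → Set
OneLine n = Vec (Fin n) n

S : ∀ n → List (OneLine n)
S n = filter (allPairs? λ i j → ¬? (i Fin.≟ j)) (words (allFin n) n)

τ : ∀ {n} → OneLine n → ℕ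
τ {n} σ = length (filter inversion? (cartesianProduct (allFin n) (allFin n)))
  where
  inversion? = λ ((i , j) : Fin n × Fin n) →
    (i Fin.<? j) ×-dec (lookup σ j Fin.<? lookup σ i)

S⟨_⟩ : Parity → ∀ n → List (OneLine n)
S⟨ p ⟩ n = filter (λ σ → parity (τ σ) Parity.≟ p) (S n)

------------------------------------------------------------------------
-- Subdiagonals

-- Applied to allFin n, this lists the tuples i₁ < ⋯ < iₖ in Fin n.
combinations : ∀ {a} {A : Set a} → ℕ → List A → List (List A)
combinations zero    xs       = [] ∷ []
combinations (suc k) []       = []
combinations (suc k) (x ∷ xs) =
  map (x ∷_) (combinations k xs) ++ combinations (suc k) xs

-- The set of positions (i , σ(i)) of a subdiagonal, listed by increasing
-- row; two subdiagonals have the same set of positions exactly when these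
-- lists are equal.
Subdiagonal : ℕ → Set
Subdiagonal n = List (Fin n × Fin n)

_≟ˢ_ : ∀ {n} → DecidableEquality (Subdiagonal n)
_≟ˢ_ = List.≡-dec (Product.≡-dec Fin._≟_ Fin._≟_)

subdiagonals : ∀ {n} → ℕ → OneLine n → List (Subdiagonal n)
subdiagonals {n} k σ =
  map (map λ i → i , lookup σ i) (combinations k (allFin n))

-- A set, hence the deduplication: for small k, one subdiagonal lies on
-- several diagonals.
L⟨_⟩ : Parity → ∀ n k → List (Subdiagonal n)
L⟨ p ⟩ n k = deduplicate _≟ˢ_ (concatMap (subdiagonals k) (S⟨ p ⟩ n))

Lᵉ Lᵒ : ∀ n k → List (Subdiagonal n)
Lᵉ = L⟨ 0ℙ ⟩
Lᵒ = L⟨ 1ℙ ⟩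

------------------------------------------------------------------------
-- Matrices over a commutative ring

module OverRing {c ℓ} (K : CommutativeRing c ℓ) where
  open CommutativeRing K
  open import Algebra.Definitions.RawSemiring (Semiring.rawSemiring semiring) public
    using (_^_) renaming (_×_ to _×ℕ_)

  infixr 8 _·_

  _·_ : ℤ → Carrier → Carrier
  (+ n)    · x = n ×ℕ x
  -[1+ n ] · x = - (suc n ×ℕ x)

  WithDivisionByIntegers : Set _
  WithDivisionByIntegers =
    ∀ (m : ℤ) .{{_ : NonZero m}} → Bijective _≈_ _≈_ (m ·_)

  module Division (div : WithDivisionByIntegers) where

    1/ : ∀ (m : ℤ) .{{_ : NonZero m}} → Carrier → Carrier
    1/ m x = proj₁ (proj₂ (div m) x)

    1/_! : ℕ → Carrier → Carrier
    1/ n ! = 1/ (+ (n !)) {{n !≢0}}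

  infixr 5 ∑ ∏

  ∑ ∏ : ∀ {a} {I : Set a} → List I → (I → Carrier) → Carrier
  ∑ xs f = foldr _+_ 0# (map f xs)
  ∏ xs f = foldr _*_ 1# (map f xs)

  syntax ∑ xs (λ x → e) = ∑[ x ← xs ] e
  syntax ∏ xs (λ x → e) = ∏[ x ← xs ] e

  Matrix : ℕ → Set c
  Matrix n = Fin n → Fin n → Carrier

  -1^_ : ℕ → Carrier
  -1^ m = (- 1#) ^ m

  det : ∀ {n} → Matrix n → Carrier
  det {n} A = ∑[ σ ← S n ] (-1^ τ σ * (∏[ i ← allFin n ] A i (lookup σ i)))

  su : ∀ {n} → Matrix n → Subdiagonal n → Carrier
  su A l = ∑[ p ← l ] A (proj₁ p) (proj₂ p)

{-# OPTIONS --safe #-}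
module Submission where

-- For fixed σ, the alternating sum over the subsets J of the rows of
-- (γ + Σ_{j ∈ J} a_{jσ(j)})ⁿ is the n-fold difference of t ↦ (γ + t)ⁿ with
-- the steps a_{jσ(j)}, that is, n! ∏ a_{jσ(j)}; the first formula follows by
-- summation over σ.  When γ is constant, the terms with |J| ≤ n − 2 cancel:
-- extend the sign by 0 to all words; it is then antisymmetric under exchange
-- of two letters, while the summand does not see two of the positions, so
-- the sum over all words equals its own negative.  The terms with |J| ≥ n − 1
-- are indexed by subdiagonals, since a permutation is determined by its
-- values at n − 1 points.

open import Defs
open import Algebra.Bundles using (CommutativeRing; CommutativeMonoid)
import Algebra.Properties.CommutativeSemigroup as CommutativeSemigroupProperties
import Algebra.Properties.Ring as RingProperties
import Algebra.Properties.Semiring.Exp as Exp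
import Algebra.Properties.Semiring.Mult as Mult
import Algebra.Solver.Ring.NaturalCoefficients.Default as SemiringSolver
open import Data.Bool.Base using (true; false; if_then_else_; _∧_)
open import Data.Fin.Base using (Fin; zero; suc; punchOut)
import Data.Fin.Properties as Fin
open import Data.Integer.Base using (+_)
open import Data.List.Base using (List; []; _∷_; _++_; map; foldr; filter; length; concatMap; deduplicate; cartesianProductWith; cartesianProduct; upTo; allFin)
open import Data.List.Membership.Propositional using (_∈_; _∉_; find)
open import Data.List.Membership.Propositional.Properties using (∈-++⁻; ∈-map⁻; ∈-concatMap⁻; ∈-allFin; ∈-filter⁻; ∈-upTo⁻)
open import Data.List.Properties using (filter-all; map-id; map-injective; map-tabulate; map-upTo; map-∘; ∷-injective; ∷-injectiveʳ; length-tabulate; upTo-∷ʳ)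
open import Data.List.Relation.Binary.Sublist.Propositional as Sublist using (_⊆_; []; _∷_; _∷ʳ_; minimum)
open import Data.List.Relation.Binary.Sublist.Propositional.Properties using (length-mono-≤)
open import Data.List.Relation.Unary.All as ListAll using ([]; _∷_)
open import Data.List.Relation.Unary.AllPairs using ([]; _∷_)
open import Data.List.Relation.Unary.Any using (here; there)
open import Data.List.Relation.Unary.Unique.Propositional using (Unique)
import Data.List.Relation.Unary.Unique.Propositional.Properties as Unique
open import Data.Nat.Base as ℕ using (ℕ; zero; suc; pred; _∸_; NonZero; _≤_; s≤s; _!)
import Data.Nat.Properties as ℕ
open import Data.Parity.Base using (Parity; 0ℙ; 1ℙ)
import Data.Parity.Properties as Parity
open import Data.Product.Base using (_×_; _,_; ∃; ∃₂; proj₁; proj₂)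
open import Data.Sum.Base using (inj₁; inj₂)
open import Data.Unit.Polymorphic.Base using (⊤)
open import Data.Vec.Base using (Vec; []; _∷_; lookup; toList; _[_]≔_)
import Data.Vec.Properties as Vec
open import Data.Vec.Relation.Binary.Pointwise.Extensional using (ext; Pointwise-≡⇒≡)
open import Data.Vec.Relation.Unary.All as All using (All; []; _∷_)
open import Data.Vec.Relation.Unary.AllPairs using (AllPairs; allPairs?; []; _∷_)
import Data.Vec.Relation.Unary.Unique.Propositional.Properties as VecUnique
open import Function.Base using (_∘_; id)
open import Function.Definitions using (Injective)
open import Level using (_⊔_)
open import Relation.Binary.Definitions using (DecidableEquality; tri<; tri≈; tri>)
open import Relation.Binary.PropositionalEquality as ≡ using (_≡_; _≢_)
import Relation.Binary.Reasoning.Setoid as SetoidReasoning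
open import Relation.Nullary.Decidable using (Dec; does; yes; no; ¬?; dec-true; dec-false)
open import Relation.Nullary.Negation using (¬_; contradiction)
open import Relation.Unary using (Decidable)

-- Summing over words rather than permutations avoids the question of how a transposition changes
-- the inversion number. Antisymmetry has to be seen only in two leading letters, and induction on
-- the word does the rest. "Equal to its own negative, hence zero" needs injectivity of doubling, so
-- division by integers is used there as well as for the factor 1/n!. No formal polynomials occur:
-- degree is a property of functions on `K`, tested by repeated differences, and n! arises as the
-- product of the degrees n, n - 1, ..., 1 that are used up. The sets of subdiagonals are
-- deduplicated lists, so the passage from pairs (σ, J) to subdiagonals requires a proof that
-- nothing is removed.

allFin-suc : ∀ n → allFin (suc n) ≡ zero ∷ map suc (allFin n)
allFin-suc n = ≡.cong (zero ∷_) (≡.sym (map-tabulate id suc))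

upTo-suc : ∀ n → upTo (suc n) ≡ 0 ∷ map suc (upTo n)
upTo-suc n = ≡.cong (0 ∷_) (≡.sym (map-upTo suc n))

-- Pigeonhole: if `y` were missed, punching it out of the codomain would give an injection from
-- `suc n` elements into `n`.
injective⇒surjective : ∀ {n} {f : Fin n → Fin n} → Injective _≡_ _≡_ f → ∀ y → ∃ λ x → f x ≡ y
injective⇒surjective {suc n} {f} inj y with Fin.any? (λ x → f x Fin.≟ y)
... | yes hit = hit
... | no miss = contradiction (Fin.injective⇒≤ punched) ℕ.1+n≰n
  where
  y≢f : ∀ x → y ≢ f x
  y≢f x y≡fx = miss (x , ≡.sym y≡fx)
  punched : Injective _≡_ _≡_ (λ x → punchOut (y≢f x))
  punched = inj ∘ Fin.punchOut-injective (y≢f _) (y≢f _)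

-- Duplicate-free lists and the entries that a sublist omits

module _ {a} {A : Set a} where

  deduplicate-unique : (_≟_ : DecidableEquality A) → ∀ {xs} → Unique xs → deduplicate _≟_ xs ≡ xs
  deduplicate-unique _≟_ []            = ≡.refl
  deduplicate-unique _≟_ (x∉xs ∷ xs!) rewrite deduplicate-unique _≟_ xs! =
    ≡.cong (_ ∷_) (filter-all _ x∉xs)

  words-unique : ∀ {xs : List A} m → Unique xs → Unique (words xs m)
  words-unique zero    xs! = [] ∷ []
  words-unique (suc m) xs! =
    Unique.cartesianProductWith⁺ _∷_ Vec.∷-injective xs! (words-unique m xs!)

  combinations⇒⊆ : ∀ k {xs js : List A} → js ∈ combinations k xs → js ⊆ xs × length js ≡ k
  combinations⇒⊆ zero    (here ≡.refl) = minimum _ , ≡.refl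
  combinations⇒⊆ (suc k) {x ∷ xs} js∈ with ∈-++⁻ (map (x ∷_) (combinations k xs)) js∈
  ... | inj₂ skip = let js⊆xs , |js|≡ = combinations⇒⊆ (suc k) skip in x ∷ʳ js⊆xs , |js|≡
  ... | inj₁ take with ∈-map⁻ (x ∷_) take
  ...   | js′ , js′∈ , ≡.refl =
          let js′⊆xs , |js′|≡ = combinations⇒⊆ k js′∈ in ≡.refl ∷ js′⊆xs , ≡.cong suc |js′|≡

  combinations-unique : ∀ k {xs : List A} → Unique xs → Unique (combinations k xs)
  combinations-unique zero    xs!           = [] ∷ []
  combinations-unique (suc k) []            = []
  combinations-unique (suc k) {x ∷ xs} (x∉xs ∷ xs!) = Unique.++⁺
    (Unique.map⁺ ∷-injectiveʳ (combinations-unique k xs!))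
    (combinations-unique (suc k) xs!)
    λ (take , skip) → take⇒¬skip take skip
    where
    take⇒¬skip : ∀ {js} → js ∈ map (x ∷_) (combinations k xs) → js ∉ combinations (suc k) xs
    take⇒¬skip take skip with ∈-map⁻ (x ∷_) take
    ... | js′ , _ , ≡.refl =
      ListAll.lookup x∉xs (Sublist.lookup (proj₁ (combinations⇒⊆ (suc k) skip)) (here ≡.refl)) ≡.refl

  -- A skipped entry is a missed one because `xs` has no repetitions: otherwise the same value could
  -- be chosen at another place.
  ⊆-misses-one : ∀ {js xs : List A} → js ⊆ xs → suc (length js) ≤ length xs → Unique xs →
    ∃ λ i → i ∈ xs × i ∉ js
  ⊆-misses-one (y ∷ʳ js⊆xs) _ (y∉xs ∷ _) =
    y , here ≡.refl , λ y∈js → ListAll.lookup y∉xs (Sublist.lookup js⊆xs y∈js) ≡.refl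
  ⊆-misses-one (≡.refl ∷ js⊆xs) (s≤s lt) (x∉xs ∷ xs!) =
    let i , i∈xs , i∉js = ⊆-misses-one js⊆xs lt xs! in
    i , there i∈xs , λ where
      (here ≡.refl) → ListAll.lookup x∉xs i∈xs ≡.refl
      (there i∈js)  → i∉js i∈js

  ⊆-misses-two : ∀ {js xs : List A} → js ⊆ xs → 2 ℕ.+ length js ≤ length xs → Unique xs →
    ∃₂ λ i j → i ≢ j × (i ∈ xs × i ∉ js) × (j ∈ xs × j ∉ js)
  ⊆-misses-two (y ∷ʳ js⊆xs) (s≤s lt) (y∉xs ∷ xs!) =
    let j , j∈xs , j∉js = ⊆-misses-one js⊆xs lt xs! in
    y , j , ListAll.lookup y∉xs j∈xs ,
    (here ≡.refl , λ y∈js → ListAll.lookup y∉xs (Sublist.lookup js⊆xs y∈js) ≡.refl) ,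
    (there j∈xs , j∉js)
  ⊆-misses-two (≡.refl ∷ js⊆xs) (s≤s lt) (x∉xs ∷ xs!) =
    let i , j , i≢j , (i∈xs , i∉js) , (j∈xs , j∉js) = ⊆-misses-two js⊆xs lt xs! in
    i , j , i≢j ,
    (there i∈xs , λ where
      (here ≡.refl) → ListAll.lookup x∉xs i∈xs ≡.refl
      (there i∈js)  → i∉js i∈js) ,
    (there j∈xs , λ where
      (here ≡.refl) → ListAll.lookup x∉xs j∈xs ≡.refl
      (there j∈js)  → j∉js j∈js)

  ⊆-misses-none : ∀ {js xs : List A} → js ⊆ xs → length xs ≤ length js →
    ∀ {i} → i ∈ xs → i ∈ js
  ⊆-misses-none (y ∷ʳ js⊆xs) le i∈xs =
    contradiction (ℕ.≤-trans le (length-mono-≤ js⊆xs)) ℕ.1+n≰n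
  ⊆-misses-none (≡.refl ∷ js⊆xs) (s≤s le) (here ≡.refl) = here ≡.refl
  ⊆-misses-none (≡.refl ∷ js⊆xs) (s≤s le) (there i∈xs)  = there (⊆-misses-none js⊆xs le i∈xs)

  -- The lengths leave room for one skip. Once it is spent, the rest of `js` exhausts the rest of
  -- `xs` by `⊆-misses-none`, so a second missed entry is impossible.
  ⊆-misses-at-most-one : ∀ {js xs : List A} → js ⊆ xs → length xs ≤ suc (length js) →
    ∀ {i j} → i ∈ xs → i ∉ js → j ∈ xs → j ∉ js → i ≡ j
  ⊆-misses-at-most-one (y ∷ʳ js⊆xs) (s≤s le) (here ≡.refl) _ (here ≡.refl) _ = ≡.refl
  ⊆-misses-at-most-one (y ∷ʳ js⊆xs) (s≤s le) (there i∈xs) i∉js _ _ =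
    contradiction (⊆-misses-none js⊆xs le i∈xs) i∉js
  ⊆-misses-at-most-one (y ∷ʳ js⊆xs) (s≤s le) _ _ (there j∈xs) j∉js =
    contradiction (⊆-misses-none js⊆xs le j∈xs) j∉js
  ⊆-misses-at-most-one (≡.refl ∷ _) _ (here ≡.refl) i∉js _ _ =
    contradiction (here ≡.refl) i∉js
  ⊆-misses-at-most-one (≡.refl ∷ _) _ _ _ (here ≡.refl) j∉js =
    contradiction (here ≡.refl) j∉js
  ⊆-misses-at-most-one (≡.refl ∷ js⊆xs) (s≤s le) (there i∈xs) i∉js (there j∈xs) j∉js =
    ⊆-misses-at-most-one js⊆xs le i∈xs (i∉js ∘ there) j∈xs (j∉js ∘ there)

  map≡map⇒≗ : ∀ {b} {B : Set b} {f g : A → B} {xs : List A} → map f xs ≡ map g xs →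
    ∀ {x} → x ∈ xs → f x ≡ g x
  map≡map⇒≗ eq (here ≡.refl) = proj₁ (∷-injective eq)
  map≡map⇒≗ eq (there x∈xs)  = map≡map⇒≗ (proj₂ (∷-injective eq)) x∈xs

-- Long subdiagonals determine their permutation

module _ {n : ℕ} where

  |allFin|≡n : length (allFin n) ≡ n
  |allFin|≡n = length-tabulate id

  Distinct : OneLine n → Set
  Distinct = AllPairs _≢_

  -- For `i` outside `js`, take `j` with σ(j) = ρ(i). If `j` were in `js`, then ρ(j) = σ(j) = ρ(i)
  -- would force j = i. So `i` and `j` are both omitted, and since at most one index is omitted they
  -- coincide.
  agree⇒≡ : ∀ {σ ρ : OneLine n} → Distinct σ → Distinct ρ → ∀ {js : List (Fin n)} →
    js ⊆ allFin n → n ≤ suc (length js) →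
    (∀ {j} → j ∈ js → lookup σ j ≡ lookup ρ j) → σ ≡ ρ
  agree⇒≡ {σ} {ρ} σ! ρ! {js} js⊆ n≤ agree = Pointwise-≡⇒≡ (ext same)
    where
    same : ∀ i → lookup σ i ≡ lookup ρ i
    same i with injective⇒surjective (VecUnique.lookup-injective σ! _ _) (lookup ρ i)
    ... | j , σj≡ρi with j ∈? js | i ∈? js
      where open import Data.List.Membership.DecPropositional (Fin._≟_ {n}) using (_∈?_)
    ...   | _        | yes i∈js = agree i∈js
    ...   | yes j∈js | no i∉js =
            contradiction
              (≡.subst (_∈ js)
                (VecUnique.lookup-injective ρ! j i (≡.trans (≡.sym (agree j∈js)) σj≡ρi)) j∈js)
              i∉js
    ...   | no j∉js  | no i∉js =
            ≡.trans (≡.cong (lookup σ)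
              (⊆-misses-at-most-one js⊆ (≡.subst (_≤ suc (length js)) (≡.sym |allFin|≡n) n≤)
                (∈-allFin i) i∉js (∈-allFin j) j∉js)) σj≡ρi

  positions : OneLine n → Fin n → Fin n × Fin n
  positions σ i = i , lookup σ i

  subdiagonals-unique : ∀ k σ → Unique (subdiagonals k σ)
  subdiagonals-unique k σ =
    Unique.map⁺ (map-injective (≡.cong proj₁)) (combinations-unique k (Unique.allFin⁺ n))

  rows : ∀ σ js → map proj₁ (map (positions σ) js) ≡ js
  rows σ js = ≡.trans (≡.sym (map-∘ js)) (map-id js)

  -- The first coordinates of `l` recover the chosen rows, so both row choices are the same list,
  -- and the second coordinates say that σ and ρ agree on it.
  common-subdiagonal⇒≡ : ∀ {k σ ρ l} → n ≤ suc k → Distinct σ → Distinct ρ →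
    l ∈ subdiagonals k σ → l ∈ subdiagonals k ρ → σ ≡ ρ
  common-subdiagonal⇒≡ {k} {σ} {ρ} n≤1+k σ! ρ! l∈σ l∈ρ
    with ∈-map⁻ (map (positions σ)) l∈σ | ∈-map⁻ (map (positions ρ)) l∈ρ
  ... | js , js∈ , ≡.refl | js′ , _ , eq
    with ≡.trans (≡.sym (rows σ js)) (≡.trans (≡.cong (map proj₁) eq) (rows ρ js′))
  ... | ≡.refl =
    let js⊆ , |js|≡k = combinations⇒⊆ k js∈ in
    agree⇒≡ σ! ρ! js⊆ (≡.subst (λ m → n ≤ suc m) (≡.sym |js|≡k) n≤1+k)
      (≡.cong proj₂ ∘ map≡map⇒≗ eq)

  concatMap-subdiagonals-unique : ∀ {k} → n ≤ suc k → ∀ {ss} → ListAll.All Distinct ss →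
    Unique ss → Unique (concatMap (subdiagonals k) ss)
  concatMap-subdiagonals-unique n≤1+k []        []           = []
  concatMap-subdiagonals-unique {k} n≤1+k {σ ∷ ss} (σ! ∷ ss!) (σ∉ss ∷ uniq) = Unique.++⁺
    (subdiagonals-unique k σ)
    (concatMap-subdiagonals-unique n≤1+k ss! uniq)
    λ (l∈σ , l∈ss) →
      let ρ , ρ∈ss , l∈ρ = find (∈-concatMap⁻ (subdiagonals k) {xs = ss} l∈ss) in
      ListAll.lookup σ∉ss ρ∈ss
        (common-subdiagonal⇒≡ {k} n≤1+k σ! (ListAll.lookup ss! ρ∈ss) l∈σ l∈ρ)

  -- Different permutations share no subdiagonal of this length, so deduplication removes nothing
  -- and a sum over the set becomes a double sum over permutations and row choices.
  L≡concatMap : ∀ p {k} → n ≤ suc k → L⟨ p ⟩ n k ≡ concatMap (subdiagonals k) (S⟨ p ⟩ n)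
  L≡concatMap p n≤1+k = deduplicate-unique _≟ˢ_
    (concatMap-subdiagonals-unique n≤1+k
      (ListAll.tabulate λ σ∈ → proj₂ (∈-filter⁻ distinct? {xs = words (allFin n) n}
        (proj₁ (∈-filter⁻ parity? {xs = S n} σ∈))))
      (Unique.filter⁺ parity? (Unique.filter⁺ distinct? (words-unique n (Unique.allFin⁺ n)))))
    where
    distinct? = allPairs? λ (i j : Fin n) → ¬? (i Fin.≟ j)
    parity? = λ (σ : OneLine n) → ℕ.parity (τ σ) Parity.≟ p

-- Big operators in a commutative monoid

module BigOperator {c ℓ} (M : CommutativeMonoid c ℓ) where
  open CommutativeMonoid M
  open CommutativeSemigroupProperties commutativeSemigroup using (interchange)
  open SetoidReasoning setoid

  -- For addition and multiplication this unfolds to `∑` and `∏` definitionally, so every law below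
  -- serves both.
  ⨁ : ∀ {a} {I : Set a} → List I → (I → Carrier) → Carrier
  ⨁ xs f = foldr _∙_ ε (map f xs)

  module _ {a} {I : Set a} where

    ⨁-cong-∈ : ∀ xs {f g : I → Carrier} → (∀ {x} → x ∈ xs → f x ≈ g x) → ⨁ xs f ≈ ⨁ xs g
    ⨁-cong-∈ []       f≈g = refl
    ⨁-cong-∈ (x ∷ xs) f≈g = ∙-cong (f≈g (here ≡.refl)) (⨁-cong-∈ xs (f≈g ∘ there))

    ⨁-cong : ∀ xs {f g : I → Carrier} → (∀ x → f x ≈ g x) → ⨁ xs f ≈ ⨁ xs g
    ⨁-cong xs f≈g = ⨁-cong-∈ xs (λ {x} _ → f≈g x)

    ⨁-++ : ∀ xs ys (f : I → Carrier) → ⨁ (xs ++ ys) f ≈ ⨁ xs f ∙ ⨁ ys f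
    ⨁-++ []       ys f = sym (identityˡ _)
    ⨁-++ (x ∷ xs) ys f = trans (∙-congˡ (⨁-++ xs ys f)) (sym (assoc _ _ _))

    ⨁-ε : ∀ (xs : List I) → ⨁ xs (λ _ → ε) ≈ ε
    ⨁-ε []       = refl
    ⨁-ε (x ∷ xs) = trans (identityˡ _) (⨁-ε xs)

    ⨁-∙ : ∀ xs (f g : I → Carrier) → ⨁ xs (λ x → f x ∙ g x) ≈ ⨁ xs f ∙ ⨁ xs g
    ⨁-∙ []       f g = sym (identityˡ _)
    ⨁-∙ (x ∷ xs) f g = trans (∙-congˡ (⨁-∙ xs f g)) (interchange _ _ _ _)

    ⨁-filter : ∀ {p} {P : I → Set p} (P? : Decidable P) xs (f : I → Carrier) →
      ⨁ (filter P? xs) f ≈ ⨁ xs (λ x → if does (P? x) then f x else ε)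
    ⨁-filter P? []       f = refl
    ⨁-filter P? (x ∷ xs) f with does (P? x)
    ... | true  = ∙-congˡ (⨁-filter P? xs f)
    ... | false = trans (⨁-filter P? xs f) (sym (identityˡ _))

  module _ {a b} {I : Set a} {J : Set b} where

    ⨁-map : ∀ (g : I → J) xs f → ⨁ (map g xs) f ≡ ⨁ xs (f ∘ g)
    ⨁-map g []       f = ≡.refl
    ⨁-map g (x ∷ xs) f = ≡.cong (f (g x) ∙_) (⨁-map g xs f)

    ⨁-concatMap : ∀ (g : I → List J) xs f →
      ⨁ (concatMap g xs) f ≈ ⨁ xs (λ x → ⨁ (g x) f)
    ⨁-concatMap g []       f = refl
    ⨁-concatMap g (x ∷ xs) f = trans (⨁-++ (g x) _ f) (∙-congˡ (⨁-concatMap g xs f))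

    ⨁-swap : ∀ xs ys (f : I → J → Carrier) →
      ⨁ xs (λ x → ⨁ ys (f x)) ≈ ⨁ ys (λ y → ⨁ xs (λ x → f x y))
    ⨁-swap []       ys f = sym (⨁-ε ys)
    ⨁-swap (x ∷ xs) ys f = trans (∙-congˡ (⨁-swap xs ys f)) (sym (⨁-∙ ys _ _))

  ⨁-cartesianProductWith : ∀ {a b d} {I : Set a} {J : Set b} {H : Set d}
    (g : I → J → H) xs ys f →
    ⨁ (cartesianProductWith g xs ys) f ≈ ⨁ xs (λ x → ⨁ ys (λ y → f (g x y)))
  ⨁-cartesianProductWith g []       ys f = refl
  ⨁-cartesianProductWith g (x ∷ xs) ys f = begin
    ⨁ (map (g x) ys ++ cartesianProductWith g xs ys) f
      ≈⟨ ⨁-++ (map (g x) ys) _ f ⟩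
    ⨁ (map (g x) ys) f ∙ ⨁ (cartesianProductWith g xs ys) f
      ≈⟨ ∙-cong (reflexive (⨁-map (g x) ys f)) (⨁-cartesianProductWith g xs ys f) ⟩
    ⨁ ys (f ∘ g x) ∙ ⨁ xs (λ x → ⨁ ys (λ y → f (g x y))) ∎

  ⨁-allFin-suc : ∀ n (f : Fin (suc n) → Carrier) →
    ⨁ (allFin (suc n)) f ≡ f zero ∙ ⨁ (allFin n) (f ∘ suc)
  ⨁-allFin-suc n f = ≡.trans (≡.cong (λ xs → ⨁ xs f) (allFin-suc n))
    (≡.cong (f zero ∙_) (⨁-map suc (allFin n) f))

module Determinant {c ℓ} (K : CommutativeRing c ℓ) where
  open CommutativeRing K hiding (zero)
  open OverRing K
  open RingProperties ring
  open Mult semiring using (×-congʳ; ×-assocˡ; ×-assoc-*; ×-comm-*)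
  open Exp semiring using (^-congˡ; ^-homo-*)
  open SemiringSolver commutativeSemiring using (solve; _:+_; _:*_; _:=_)
  open CommutativeSemigroupProperties *-commutativeSemigroup
    using () renaming (interchange to *-interchange; x∙yz≈y∙xz to *-leftComm)
  open SetoidReasoning setoid
  module Sum  = BigOperator +-commutativeMonoid
  module Prod = BigOperator *-commutativeMonoid

  *-distribˡ-∑ : ∀ {a} {I : Set a} x xs (f : I → Carrier) →
    x * ∑ xs f ≈ (∑[ i ← xs ] x * f i)
  *-distribˡ-∑ x []       f = zeroʳ x
  *-distribˡ-∑ x (i ∷ xs) f = trans (distribˡ x _ _) (+-congˡ (*-distribˡ-∑ x xs f))

  ∑-neg : ∀ {a} {I : Set a} xs (f : I → Carrier) → (∑[ i ← xs ] - f i) ≈ - ∑ xs f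
  ∑-neg xs f = begin
    (∑[ i ← xs ] - f i)        ≈⟨ Sum.⨁-cong xs (λ i → sym (-1*x≈-x (f i))) ⟩
    (∑[ i ← xs ] - 1# * f i)   ≈⟨ sym (*-distribˡ-∑ (- 1#) xs f) ⟩
    - 1# * ∑ xs f              ≈⟨ -1*x≈-x _ ⟩
    - ∑ xs f                   ∎

  ∑-zero : ∀ {a} {I : Set a} xs {f : I → Carrier} → (∀ {i} → i ∈ xs → f i ≈ 0#) → ∑ xs f ≈ 0#
  ∑-zero xs f≈0 = trans (Sum.⨁-cong-∈ xs f≈0) (Sum.⨁-ε xs)

  -- Finite differences of polynomial functions

  Δ : Carrier → (Carrier → Carrier) → Carrier → Carrier
  Δ a h t = h (a + t) - h t

  -- Degree≤ d c h says that h behaves like a polynomial function of degree at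
  -- most d whose coefficient of tᵈ is c.
  Degree≤ : ℕ → Carrier → (Carrier → Carrier) → Set _
  Degree≤ zero    c h = ∀ t → h t ≈ c
  Degree≤ (suc d) c h = ∀ a → Degree≤ d (suc d ×ℕ (a * c)) (Δ a h)

  Degree≤-cong : ∀ d {c c′ h h′} → c ≈ c′ → (∀ t → h t ≈ h′ t) →
    Degree≤ d c h → Degree≤ d c′ h′
  Degree≤-cong zero    c≈ h≈ D t = trans (sym (h≈ t)) (trans (D t) c≈)
  Degree≤-cong (suc d) c≈ h≈ D a = Degree≤-cong d (×-congʳ (suc d) (*-congˡ c≈))
    (λ t → +-cong (h≈ (a + t)) (-‿cong (h≈ t))) (D a)

  -- Turns an integer multiple into a product, with `m ×ℕ 1#` as an atom for the semiring solver.
  ×ℕ-* : ∀ m x → m ×ℕ x ≈ (m ×ℕ 1#) * x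
  ×ℕ-* m x = sym (trans (×-assoc-* m 1# x) (×-congʳ m (*-identityˡ x)))

  -- Brings subtraction within reach of a semiring solver: `- 1#` becomes a variable, and the
  -- identities solved this way hold for every value of it.
  -‿*-1 : ∀ x y → x - y ≈ x + - 1# * y
  -‿*-1 x y = +-congˡ (sym (-1*x≈-x y))

  [w-x]-[y-z]≈[w-y]-[x-z] : ∀ w x y z → (w - x) - (y - z) ≈ (w - y) - (x - z)
  [w-x]-[y-z]≈[w-y]-[x-z] w x y z = begin
    (w - x) - (y - z)
      ≈⟨ trans (-‿*-1 _ _) (+-cong (-‿*-1 _ _) (*-congˡ (-‿*-1 _ _))) ⟩
    (w + - 1# * x) + - 1# * (y + - 1# * z)
      ≈⟨ solve 5 (λ m w x y z → (w :+ m :* x) :+ m :* (y :+ m :* z)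
                    := (w :+ m :* y) :+ m :* (x :+ m :* z)) refl (- 1#) w x y z ⟩
    (w + - 1# * y) + - 1# * (x + - 1# * z)
      ≈⟨ sym (trans (-‿*-1 _ _) (+-cong (-‿*-1 _ _) (*-congˡ (-‿*-1 _ _)))) ⟩
    (w - y) - (x - z) ∎

  Degree≤-+ : ∀ d {c c′ h h′} → Degree≤ d c h → Degree≤ d c′ h′ →
    Degree≤ d (c + c′) (λ t → h t + h′ t)
  Degree≤-+ zero D D′ t = +-cong (D t) (D′ t)
  Degree≤-+ (suc d) {c} {c′} {h} {h′} D D′ a = Degree≤-cong d
    (begin
      suc d ×ℕ (a * c) + suc d ×ℕ (a * c′)
        ≈⟨ +-cong (×ℕ-* (suc d) _) (×ℕ-* (suc d) _) ⟩
      (suc d ×ℕ 1#) * (a * c) + (suc d ×ℕ 1#) * (a * c′)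
        ≈⟨ solve 4 (λ m a c c′ → m :* (a :* c) :+ m :* (a :* c′) := m :* (a :* (c :+ c′)))
                 refl (suc d ×ℕ 1#) a c c′ ⟩
      (suc d ×ℕ 1#) * (a * (c + c′))
        ≈⟨ sym (×ℕ-* (suc d) _) ⟩
      suc d ×ℕ (a * (c + c′)) ∎)
    (λ t → begin
      (h (a + t) - h t) + (h′ (a + t) - h′ t)
        ≈⟨ +-cong (-‿*-1 _ _) (-‿*-1 _ _) ⟩
      (h (a + t) + - 1# * h t) + (h′ (a + t) + - 1# * h′ t)
        ≈⟨ solve 5 (λ m p q p′ q′ → (p :+ m :* q) :+ (p′ :+ m :* q′)
                      := (p :+ p′) :+ m :* (q :+ q′))
                 refl (- 1#) (h (a + t)) (h t) (h′ (a + t)) (h′ t) ⟩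
      (h (a + t) + h′ (a + t)) + - 1# * (h t + h′ t)
        ≈⟨ sym (-‿*-1 _ _) ⟩
      (h (a + t) + h′ (a + t)) - (h t + h′ t) ∎)
    (Degree≤-+ d (D a) (D′ a))

  Degree≤-scale : ∀ d x {c h} → Degree≤ d c h → Degree≤ d (x * c) (λ t → x * h t)
  Degree≤-scale zero x D t = *-congˡ (D t)
  Degree≤-scale (suc d) x {c} {h} D a = Degree≤-cong d
    (begin
      x * (suc d ×ℕ (a * c))     ≈⟨ ×-comm-* (suc d) x _ ⟩
      suc d ×ℕ (x * (a * c))     ≈⟨ ×-congʳ (suc d)
        (solve 3 (λ x a c → x :* (a :* c) := a :* (x :* c)) refl x a c) ⟩
      suc d ×ℕ (a * (x * c))     ∎)
    (λ t → x[y-z]≈xy-xz x (h (a + t)) (h t))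
    (Degree≤-scale d x (D a))

  -- In the product rule below, the term `a * Δ a h` has smaller degree than the others. Raised to
  -- their degree, it contributes 0 to the leading coefficient.
  Degree≤-suc : ∀ d {c h} → Degree≤ d c h → Degree≤ (suc d) 0# h
  Degree≤-suc zero D a t = trans (+-cong (D (a + t)) (-‿cong (D t)))
    (trans (-‿inverseʳ _) (sym (trans (+-identityʳ _) (zeroʳ a))))
  Degree≤-suc (suc d) D a = Degree≤-cong (suc d)
    (sym (trans (×ℕ-* (suc (suc d)) _) (trans (*-congˡ (zeroʳ a)) (zeroʳ _))))
    (λ _ → refl) (Degree≤-suc d (D a))

  -- By the product rule `leibniz`, the difference of (x + t) h(t) is (x + t) Δh + a h + a Δh. For d
  -- > 0 the first term has leading coefficient d a c by induction, the second a c, the third 0, in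
  -- total (d + 1) a c. For d = 0 the function is constant and both terms with Δh vanish.
  Degree≤-* : ∀ d x {c h} → Degree≤ d c h → Degree≤ (suc d) c (λ t → (x + t) * h t)
  Degree≤-* d x {c} {h} D a = product d D
    where
    leibniz : ∀ t → (x + t) * Δ a h t + (a * h t + a * Δ a h t) ≈ Δ a (λ t → (x + t) * h t) t
    leibniz t = begin
      (x + t) * Δ a h t + (a * h t + a * Δ a h t)
        ≈⟨ +-congˡ (sym (distribˡ a _ _)) ⟩
      (x + t) * Δ a h t + a * (h t + (h (a + t) - h t))
        ≈⟨ +-cong (*-congˡ (-‿*-1 _ _))
                  (*-congˡ (trans (sym (+-assoc _ _ _)) (xyx⁻¹≈y _ _))) ⟩
      (x + t) * (h (a + t) + - 1# * h t) + a * h (a + t)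
        ≈⟨ solve 6 (λ x t a m p q → (x :+ t) :* (p :+ m :* q) :+ a :* p
                      := (x :+ (a :+ t)) :* p :+ m :* ((x :+ t) :* q))
                 refl x t a (- 1#) (h (a + t)) (h t) ⟩
      (x + (a + t)) * h (a + t) + - 1# * ((x + t) * h t)
        ≈⟨ sym (-‿*-1 _ _) ⟩
      Δ a (λ t → (x + t) * h t) t ∎

    product : ∀ d → Degree≤ d c h → Degree≤ d (suc d ×ℕ (a * c)) (Δ a (λ t → (x + t) * h t))
    product zero D t = begin
      Δ a (λ t → (x + t) * h t) t
        ≈⟨ sym (leibniz t) ⟩
      (x + t) * Δ a h t + (a * h t + a * Δ a h t)
        ≈⟨ +-cong (*-congˡ Δ≈0) (+-cong (*-congˡ (D t)) (*-congˡ Δ≈0)) ⟩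
      (x + t) * 0# + (a * c + a * 0#)
        ≈⟨ +-cong (zeroʳ _) (+-congˡ (zeroʳ a)) ⟩
      0# + (a * c + 0#)
        ≈⟨ +-identityˡ _ ⟩
      a * c + 0# ∎
      where
      Δ≈0 : Δ a h t ≈ 0#
      Δ≈0 = trans (+-cong (D (a + t)) (-‿cong (D t))) (-‿inverseʳ c)
    product (suc d) D = Degree≤-cong (suc d)
      (trans (+-congˡ (trans (+-congˡ (zeroʳ a)) (+-identityʳ _))) (+-comm _ _))
      leibniz
      (Degree≤-+ (suc d) (Degree≤-* d x (D a))
        (Degree≤-+ (suc d) (Degree≤-scale (suc d) a D)
          (Degree≤-scale (suc d) a (Degree≤-suc d (D a)))))

  Degree≤-^ : ∀ d x → Degree≤ d 1# (λ t → (x + t) ^ d)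
  Degree≤-^ zero    x t = refl
  Degree≤-^ (suc d) x   = Degree≤-* d x (Degree≤-^ d x)

  module _ {a} {I : Set a} (f : I → Carrier) where

    Δ* : List I → (Carrier → Carrier) → Carrier → Carrier
    Δ* []       h = h
    Δ* (x ∷ xs) h = Δ* xs (Δ (f x) h)

    -- Each difference uses up one degree and multiplies the coefficient by that degree and by the
    -- step. The degrees multiply to the factorial.
    Δ*-degree : ∀ xs {c h} → Degree≤ (length xs) c h →
      ∀ t → Δ* xs h t ≈ (length xs !) ×ℕ (∏ xs f * c)
    Δ*-degree [] {c} D t = trans (D t) (sym (trans (+-identityʳ _) (*-identityˡ c)))
    Δ*-degree (x ∷ xs) {c} D t = begin
      Δ* xs (Δ (f x) _) t
        ≈⟨ Δ*-degree xs (D (f x)) t ⟩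
      (length xs !) ×ℕ (∏ xs f * (suc (length xs) ×ℕ (f x * c)))
        ≈⟨ ×-congʳ (length xs !) (×-comm-* (suc (length xs)) _ _) ⟩
      (length xs !) ×ℕ (suc (length xs) ×ℕ (∏ xs f * (f x * c)))
        ≈⟨ ×-assocˡ _ (length xs !) (suc (length xs)) ⟩
      (length xs ! ℕ.* suc (length xs)) ×ℕ (∏ xs f * (f x * c))
        ≡⟨ ≡.cong (_×ℕ (∏ xs f * (f x * c))) (ℕ.*-comm (length xs !) (suc (length xs))) ⟩
      (suc (length xs) !) ×ℕ (∏ xs f * (f x * c))
        ≈⟨ ×-congʳ (suc (length xs) !)
             (solve 3 (λ p x c → p :* (x :* c) := (x :* p) :* c) refl (∏ xs f) (f x) c) ⟩
      (suc (length xs) !) ×ℕ (∏ (x ∷ xs) f * c) ∎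

    Δ*-cong : ∀ xs {h h′} → (∀ t → h t ≈ h′ t) → ∀ t → Δ* xs h t ≈ Δ* xs h′ t
    Δ*-cong []       h≈ t = h≈ t
    Δ*-cong (x ∷ xs) h≈ t = Δ*-cong xs (λ t → +-cong (h≈ _) (-‿cong (h≈ t))) t

    Δ*-- : ∀ xs h h′ t → Δ* xs (λ t → h t - h′ t) t ≈ Δ* xs h t - Δ* xs h′ t
    Δ*-- [] h h′ t = refl
    Δ*-- (x ∷ xs) h h′ t = trans
      (Δ*-cong xs (λ t → begin
        (h (f x + t) - h′ (f x + t)) - (h t - h′ t)
          ≈⟨ [w-x]-[y-z]≈[w-y]-[x-z] _ _ _ _ ⟩
        (h (f x + t) - h t) - (h′ (f x + t) - h′ t) ∎) t)
      (Δ*-- xs (Δ (f x) h) (Δ (f x) h′) t)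

    combinationSum : ℕ → List I → (Carrier → Carrier) → Carrier
    combinationSum k xs h = ∑[ js ← combinations k xs ] h (∑ js f)

    combinationSum-suc : ∀ k x xs h →
      combinationSum (suc k) (x ∷ xs) h
        ≈ combinationSum k xs (λ t → h (f x + t)) + combinationSum (suc k) xs h
    combinationSum-suc k x xs h = trans (Sum.⨁-++ (map (x ∷_) (combinations k xs)) _ _)
      (+-congʳ (reflexive (Sum.⨁-map (x ∷_) (combinations k xs) _)))

    -- The bound `N` is kept apart from `length xs` because the recursion on the list meets the same
    -- tail under two bounds. Levels beyond the length are empty sums.
    alternatingSum : ℕ → List I → (Carrier → Carrier) → Carrier
    alternatingSum N xs h = ∑[ k ← upTo (suc N) ] (-1^ k * combinationSum k xs h)

    -- The levels above zero, up to sign. They are separated because the Pascal recursion of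
    -- `combinations` applies only to `suc k`.
    tailSum : ℕ → List I → (Carrier → Carrier) → Carrier
    tailSum N xs h = ∑[ k ← upTo N ] (-1^ k * combinationSum (suc k) xs h)

    alternatingSum-split : ∀ N xs h → alternatingSum N xs h ≈ h 0# - tailSum N xs h
    alternatingSum-split N xs h = begin
      alternatingSum N xs h
        ≡⟨ ≡.cong (λ ks → ∑[ k ← ks ] (-1^ k * combinationSum k xs h)) (upTo-suc N) ⟩
      1# * (h 0# + 0#) + (∑[ k ← map suc (upTo N) ] (-1^ k * combinationSum k xs h))
        ≈⟨ +-cong (trans (*-identityˡ _) (+-identityʳ _))
                  (reflexive (Sum.⨁-map suc (upTo N) _)) ⟩
      h 0# + (∑[ k ← upTo N ] (- 1# * -1^ k * combinationSum (suc k) xs h))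
        ≈⟨ +-congˡ (Sum.⨁-cong (upTo N) λ k → trans (*-assoc _ _ _) (-1*x≈-x _)) ⟩
      h 0# + (∑[ k ← upTo N ] - (-1^ k * combinationSum (suc k) xs h))
        ≈⟨ +-congˡ (∑-neg (upTo N) _) ⟩
      h 0# - tailSum N xs h ∎

    tailSum-∷ : ∀ N x xs h →
      tailSum (suc N) (x ∷ xs) h ≈ alternatingSum N xs (λ t → h (f x + t)) + tailSum (suc N) xs h
    tailSum-∷ N x xs h = trans
      (Sum.⨁-cong (upTo (suc N)) λ k →
        trans (*-congˡ (combinationSum-suc k x xs h)) (distribˡ _ _ _))
      (Sum.⨁-∙ (upTo (suc N)) _ _)

    -- Split the subsets according to whether they contain `x`. Those that do carry one more sign
    -- and see `h` shifted by `f x`, so each entry contributes "identity minus shift", the negative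
    -- of its difference operator.
    alternatingSum≈Δ* : ∀ N xs h → length xs ℕ.≤ N →
      alternatingSum N xs h ≈ -1^ length xs * Δ* xs h 0#
    alternatingSum≈Δ* N [] h _ = begin
      alternatingSum N [] h
        ≈⟨ alternatingSum-split N [] h ⟩
      h 0# - tailSum N [] h
        ≈⟨ +-congˡ (-‿cong (∑-zero (upTo N) λ _ → zeroʳ _)) ⟩
      h 0# - 0#
        ≈⟨ trans (+-congˡ -0#≈0#) (+-identityʳ _) ⟩
      h 0#
        ≈⟨ sym (*-identityˡ _) ⟩
      1# * h 0# ∎
    alternatingSum≈Δ* (suc N) (x ∷ xs) h (ℕ.s≤s |xs|≤N) = begin
      alternatingSum (suc N) (x ∷ xs) h
        ≈⟨ alternatingSum-split (suc N) (x ∷ xs) h ⟩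
      h 0# - tailSum (suc N) (x ∷ xs) h
        ≈⟨ +-congˡ (-‿cong (trans (tailSum-∷ N x xs h) (+-comm _ _))) ⟩
      h 0# - (tailSum (suc N) xs h + alternatingSum N xs h[x+])
        ≈⟨ +-congˡ (sym (-‿+-comm _ _)) ⟩
      h 0# + (- tailSum (suc N) xs h - alternatingSum N xs h[x+])
        ≈⟨ sym (+-assoc _ _ _) ⟩
      (h 0# - tailSum (suc N) xs h) - alternatingSum N xs h[x+]
        ≈⟨ +-congʳ (sym (alternatingSum-split (suc N) xs h)) ⟩
      alternatingSum (suc N) xs h - alternatingSum N xs h[x+]
        ≈⟨ +-cong (alternatingSum≈Δ* (suc N) xs h (ℕ.m≤n⇒m≤1+n |xs|≤N))
                  (-‿cong (alternatingSum≈Δ* N xs h[x+] |xs|≤N)) ⟩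
      s * Δ* xs h 0# - s * Δ* xs h[x+] 0#
        ≈⟨ sym (⁻¹-anti-homo‿- _ _) ⟩
      - (s * Δ* xs h[x+] 0# - s * Δ* xs h 0#)
        ≈⟨ -‿cong (sym (x[y-z]≈xy-xz s _ _)) ⟩
      - (s * (Δ* xs h[x+] 0# - Δ* xs h 0#))
        ≈⟨ -‿cong (*-congˡ (sym (Δ*-- xs h[x+] h 0#))) ⟩
      - (s * Δ* xs (Δ (f x) h) 0#)
        ≈⟨ sym (trans (*-assoc _ _ _) (-1*x≈-x _)) ⟩
      - 1# * s * Δ* xs (Δ (f x) h) 0# ∎
      where
      h[x+] : Carrier → Carrier
      h[x+] t = h (f x + t)
      s : Carrier
      s = -1^ length xs

  -- Powers of -1 and polarization

  -1^-homo-+ : ∀ m n → -1^ (m ℕ.+ n) ≈ -1^ m * -1^ n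
  -1^-homo-+ = ^-homo-* (- 1#)

  -1^m*-1^m≈1 : ∀ m → -1^ m * -1^ m ≈ 1#
  -1^m*-1^m≈1 zero    = *-identityˡ 1#
  -1^m*-1^m≈1 (suc m) = begin
    (- 1# * -1^ m) * (- 1# * -1^ m)
      ≈⟨ *-interchange (- 1#) (-1^ m) (- 1#) (-1^ m) ⟩
    (- 1# * - 1#) * (-1^ m * -1^ m)
      ≈⟨ *-cong (trans (-1*x≈-x _) (-‿involutive 1#)) (-1^m*-1^m≈1 m) ⟩
    1# * 1#
      ≈⟨ *-identityˡ 1# ⟩
    1# ∎

  -1^-∸ : ∀ {k n} → k ℕ.≤ n → -1^ (n ℕ.∸ k) ≈ -1^ n * -1^ k
  -1^-∸ {k} {n} k≤n = begin
    -1^ (n ℕ.∸ k)                      ≈⟨ sym (*-identityʳ _) ⟩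
    -1^ (n ℕ.∸ k) * 1#                 ≈⟨ *-congˡ (sym (-1^m*-1^m≈1 k)) ⟩
    -1^ (n ℕ.∸ k) * (-1^ k * -1^ k)    ≈⟨ sym (*-assoc _ _ _) ⟩
    -1^ (n ℕ.∸ k) * -1^ k * -1^ k      ≈⟨ *-congʳ (sym (-1^-homo-+ (n ℕ.∸ k) k)) ⟩
    -1^ (n ℕ.∸ k ℕ.+ k) * -1^ k        ≡⟨ ≡.cong (λ m → -1^ m * -1^ k) (ℕ.m∸n+n≡m k≤n) ⟩
    -1^ n * -1^ k                      ∎

  -- The function t ↦ (γ + t)ⁿ has leading coefficient 1 whatever γ is, and n differences retain
  -- nothing else of it. This is why the γ are free.
  polarization : ∀ {a} {I : Set a} (f : I → Carrier) xs γ → let n = length xs in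
    (∑[ k ← upTo (suc n) ] (-1^ (n ℕ.∸ k) * combinationSum f k xs (λ t → (γ + t) ^ n)))
      ≈ (n !) ×ℕ ∏ xs f
  polarization f xs γ = begin
    (∑[ k ← upTo (suc n) ] (-1^ (n ℕ.∸ k) * combinationSum f k xs h))
      ≈⟨ Sum.⨁-cong-∈ (upTo (suc n)) (λ k∈ →
           trans (*-congʳ (-1^-∸ (ℕ.s≤s⁻¹ (∈-upTo⁻ k∈)))) (*-assoc _ _ _)) ⟩
    (∑[ k ← upTo (suc n) ] (-1^ n * (-1^ k * combinationSum f k xs h)))
      ≈⟨ sym (*-distribˡ-∑ (-1^ n) (upTo (suc n)) _) ⟩
    -1^ n * alternatingSum f n xs h
      ≈⟨ *-congˡ (alternatingSum≈Δ* f n xs h ℕ.≤-refl) ⟩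
    -1^ n * (-1^ n * Δ* f xs h 0#)
      ≈⟨ trans (sym (*-assoc _ _ _)) (trans (*-congʳ (-1^m*-1^m≈1 n)) (*-identityˡ _)) ⟩
    Δ* f xs h 0#
      ≈⟨ Δ*-degree f xs (Degree≤-^ n γ) 0# ⟩
    (n !) ×ℕ (∏ xs f * 1#)
      ≈⟨ ×-congʳ (n !) (*-identityʳ _) ⟩
    (n !) ×ℕ ∏ xs f ∎
    where
    n = length xs
    h : Carrier → Carrier
    h t = (γ + t) ^ n

  -- Alternating functions on words

  -- Antisymmetry under exchange of adjacent letters, at every depth of the word. This form follows
  -- the recursion of words and survives fixing the first letter.
  Alternating : ∀ {a} {X : Set a} {m} → (Vec X m → Carrier) → Set (a ⊔ ℓ)
  Alternating {m = zero}        F = ⊤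
  Alternating {m = suc zero}    F = ⊤
  Alternating {m = suc (suc m)} F =
    (∀ x → Alternating (λ w → F (x ∷ w))) ×
    (∀ x y w → F (x ∷ y ∷ w) ≈ - F (y ∷ x ∷ w))

  Ignores : ∀ {a} {X : Set a} {m} → Fin m → (Vec X m → Carrier) → Set (a ⊔ ℓ)
  Ignores i g = ∀ w x → g (w [ i ]≔ x) ≈ g w

  module _ {a} {X : Set a} where

    Alternating-cong : ∀ {m} {F G : Vec X m → Carrier} → (∀ w → F w ≈ G w) →
      Alternating F → Alternating G
    Alternating-cong {zero}        F≈G _ = _
    Alternating-cong {suc zero}    F≈G _ = _
    Alternating-cong {suc (suc m)} F≈G (alt , neg) =
      (λ x → Alternating-cong (λ w → F≈G (x ∷ w)) (alt x)) ,
      (λ x y w → trans (sym (F≈G _)) (trans (neg x y w) (-‿cong (F≈G _))))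

    Alternating-scale : ∀ {m} z {F : Vec X m → Carrier} →
      Alternating F → Alternating (λ w → z * F w)
    Alternating-scale {zero}        z _ = _
    Alternating-scale {suc zero}    z _ = _
    Alternating-scale {suc (suc m)} z (alt , neg) =
      (λ x → Alternating-scale z (alt x)) ,
      (λ x y w → trans (*-congˡ (neg x y w)) (sym (-‿distribʳ-* z _)))

    -- A product over all letters of `w` is symmetric in them. This carries antisymmetry from
    -- `sign w` to `sign (x ∷ w)` as a function of `w`.
    Alternating-∏ : ∀ {m} (p : X → Carrier) {F : Vec X m → Carrier} →
      Alternating F → Alternating (λ w → ∏ (toList w) p * F w)
    Alternating-∏ {zero}        p _ = _
    Alternating-∏ {suc zero}    p _ = _
    Alternating-∏ {suc (suc m)} p (alt , neg) =
      (λ x → Alternating-cong (λ w → sym (*-assoc (p x) _ _))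
               (Alternating-scale (p x) (Alternating-∏ p (alt x)))) ,
      (λ x y w → trans (*-cong (*-leftComm (p x) (p y) _) (neg x y w))
                       (sym (-‿distribʳ-* _ _)))

    swap₀₁ : ∀ {m} → Vec X (suc (suc m)) → Vec X (suc (suc m))
    swap₀₁ (x ∷ y ∷ w) = y ∷ x ∷ w

    module _ (xs : List X) where

      ∑-words-suc : ∀ m (f : Vec X (suc m) → Carrier) →
        ∑ (words xs (suc m)) f ≈ (∑[ x ← xs ] ∑[ w ← words xs m ] f (x ∷ w))
      ∑-words-suc m = Sum.⨁-cartesianProductWith _∷_ xs (words xs m)

      ∑-words-suc² : ∀ m (f : Vec X (suc (suc m)) → Carrier) →
        ∑ (words xs (suc (suc m))) f
          ≈ (∑[ x ← xs ] ∑[ y ← xs ] ∑[ w ← words xs m ] f (x ∷ y ∷ w))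
      ∑-words-suc² m f =
        trans (∑-words-suc (suc m) f) (Sum.⨁-cong xs λ x → ∑-words-suc m (λ w → f (x ∷ w)))

      ∑-words-swap₀₁ : ∀ m (f : Vec X (suc (suc m)) → Carrier) →
        ∑ (words xs (suc (suc m))) f ≈ ∑ (words xs (suc (suc m))) (λ w → f (swap₀₁ w))
      ∑-words-swap₀₁ m f = begin
        ∑ (words xs (suc (suc m))) f
          ≈⟨ ∑-words-suc² m f ⟩
        (∑[ x ← xs ] ∑[ y ← xs ] ∑[ w ← words xs m ] f (x ∷ y ∷ w))
          ≈⟨ Sum.⨁-swap xs xs _ ⟩
        (∑[ y ← xs ] ∑[ x ← xs ] ∑[ w ← words xs m ] f (x ∷ y ∷ w))
          ≈⟨ sym (∑-words-suc² m (λ w → f (swap₀₁ w))) ⟩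
        ∑ (words xs (suc (suc m))) (λ w → f (swap₀₁ w)) ∎

      ∑-alternating-swap₀₁ : ∀ {m} {F : Vec X (suc (suc m)) → Carrier} (g : Vec X (suc (suc m)) → Carrier) → Alternating F →
        (∑[ w ← words xs (suc (suc m)) ] F w * g w)
          ≈ - (∑[ w ← words xs (suc (suc m)) ] F w * g (swap₀₁ w))
      ∑-alternating-swap₀₁ {m} {F} g (_ , neg) = begin
        (∑[ w ← words xs (suc (suc m)) ] F w * g w)
          ≈⟨ ∑-words-swap₀₁ m _ ⟩
        (∑[ w ← words xs (suc (suc m)) ] F (swap₀₁ w) * g (swap₀₁ w))
          ≈⟨ Sum.⨁-cong (words xs (suc (suc m))) (λ where
               w@(x ∷ y ∷ v) → trans (*-congʳ (neg y x v)) (sym (-‿distribˡ-* (F w) (g (swap₀₁ w))))) ⟩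
        (∑[ w ← words xs (suc (suc m)) ] - (F w * g (swap₀₁ w)))
          ≈⟨ ∑-neg (words xs (suc (suc m))) _ ⟩
        - (∑[ w ← words xs (suc (suc m)) ] F w * g (swap₀₁ w)) ∎

      module _ (x≈-x⇒x≈0 : ∀ x → x ≈ - x → x ≈ 0#) where

        -- If the first two positions are ignored, `g` is invariant under their exchange and the sum
        -- is its own negative. Otherwise the exchange moves the ignored position 0 to position 1.
        -- With the new first letter fixed, it is again the leading position of a shorter word, one
        -- step closer to the other ignored position.
        ∑-alternating-vanishes₀ : ∀ {m} {F g : Vec X (suc m) → Carrier} (j : Fin m) →
          Alternating F → Ignores zero g → Ignores (suc j) g →
          (∑[ w ← words xs (suc m) ] F w * g w) ≈ 0#
        ∑-alternating-vanishes₀ {suc m} {F} {g} zero alt ig₀ ig₁ =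
          x≈-x⇒x≈0 _ (trans (∑-alternating-swap₀₁ g alt)
            (-‿cong (Sum.⨁-cong (words xs (suc (suc m))) λ w → *-congˡ (g-swap w))))
          where
          g-swap : ∀ w → g (swap₀₁ w) ≈ g w
          g-swap w@(x ∷ y ∷ v) = begin
            g (y ∷ x ∷ v)   ≈⟨ sym (ig₀ (y ∷ x ∷ v) x) ⟩
            g (x ∷ x ∷ v)   ≈⟨ ig₁ (x ∷ y ∷ v) x ⟩
            g (x ∷ y ∷ v)   ∎
        ∑-alternating-vanishes₀ {suc (suc m)} {F} {g} (suc j) alt ig₀ ig₂ = begin
          (∑[ w ← words xs (3 ℕ.+ m) ] F w * g w)
            ≈⟨ ∑-alternating-swap₀₁ g alt ⟩
          - (∑[ w ← words xs (3 ℕ.+ m) ] F w * g (swap₀₁ w))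
            ≈⟨ -‿cong (∑-words-suc (suc (suc m)) _) ⟩
          - (∑[ x ← xs ] ∑[ w ← words xs (2 ℕ.+ m) ] F (x ∷ w) * g (swap₀₁ (x ∷ w)))
            ≈⟨ -‿cong (∑-zero xs λ {x} _ → ∑-alternating-vanishes₀ j (proj₁ alt x)
                 (λ where (y ∷ w) z → ig₀ (y ∷ x ∷ w) z)
                 (λ where (y ∷ w) z → ig₂ (y ∷ x ∷ w) z)) ⟩
          - 0#
            ≈⟨ -0#≈0# ⟩
          0# ∎

        ∑-alternating-vanishes : ∀ {m} {F g : Vec X m → Carrier} {i j} → i ≢ j →
          Alternating F → Ignores i g → Ignores j g → (∑[ w ← words xs m ] F w * g w) ≈ 0#
        ∑-alternating-vanishes {i = zero}  {zero}  i≢j alt igᵢ igⱼ = contradiction ≡.refl i≢j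
        ∑-alternating-vanishes {i = zero}  {suc j} i≢j alt igᵢ igⱼ =
          ∑-alternating-vanishes₀ j alt igᵢ igⱼ
        ∑-alternating-vanishes {i = suc i} {zero}  i≢j alt igᵢ igⱼ =
          ∑-alternating-vanishes₀ i alt igⱼ igᵢ
        ∑-alternating-vanishes {suc (suc m)} {i = suc i} {suc j} i≢j alt igᵢ igⱼ = trans
          (∑-words-suc (suc m) _)
          (∑-zero xs λ {x} _ → ∑-alternating-vanishes (i≢j ∘ ≡.cong suc) (proj₁ alt x)
            (λ w → igᵢ (x ∷ w)) (λ w → igⱼ (x ∷ w)))
        ∑-alternating-vanishes {suc zero} {i = suc ()}

  -- The sign of a word and the inversion number

  module _ {n : ℕ} where

    -- The value 0# on equal letters makes sign vanish on words with
    -- repetitions, so that sums over S n become sums over all words.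
    order : Fin n → Fin n → Carrier
    order x y = if does (y Fin.<? x) then - 1# else if does (x Fin.≟ y) then 0# else 1#

    order-antisym : ∀ x y → order x y ≈ - order y x
    order-antisym x y with Fin.<-cmp x y
    ... | tri< x<y x≢y y≮x
        rewrite dec-false (y Fin.<? x) y≮x | dec-false (x Fin.≟ y) x≢y | dec-true (x Fin.<? y) x<y
        = sym (-‿involutive 1#)
    ... | tri≈ x≮y ≡.refl _
        rewrite dec-false (x Fin.<? x) x≮y | dec-true (x Fin.≟ x) ≡.refl
        = sym -0#≈0#
    ... | tri> x≮y x≢y y<x
        rewrite dec-false (x Fin.<? y) x≮y | dec-false (y Fin.≟ x) (x≢y ∘ ≡.sym) | dec-true (y Fin.<? x) y<x
        = refl

    order-refl : ∀ x → order x x ≡ 0#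
    order-refl x rewrite dec-false (x Fin.<? x) (Fin.<-irrefl ≡.refl) | dec-true (x Fin.≟ x) ≡.refl
      = ≡.refl

    -- The product of `order` over all pairs of positions i < j, grouped by the earlier position.
    sign : ∀ {m} → Vec (Fin n) m → Carrier
    sign []      = 1#
    sign (x ∷ w) = ∏ (toList w) (order x) * sign w

    sign-alternating : ∀ {m} → Alternating (sign {m})
    sign-alternating {zero}        = _
    sign-alternating {suc zero}    = _
    sign-alternating {suc (suc m)} =
      (λ x → Alternating-∏ (order x) (sign-alternating {suc m})) , λ x y w → begin
        (order x y * ∏ (toList w) (order x)) * (∏ (toList w) (order y) * sign w)
          ≈⟨ solve 4 (λ o p q s → (o :* p) :* (q :* s) := o :* (q :* (p :* s))) refl
               (order x y) _ _ _ ⟩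
        order x y * (∏ (toList w) (order y) * (∏ (toList w) (order x) * sign w))
          ≈⟨ *-congʳ (order-antisym x y) ⟩
        - order y x * (∏ (toList w) (order y) * (∏ (toList w) (order x) * sign w))
          ≈⟨ sym (-‿distribˡ-* _ _) ⟩
        - (order y x * (∏ (toList w) (order y) * (∏ (toList w) (order x) * sign w)))
          ≈⟨ -‿cong (sym (*-assoc _ _ _)) ⟩
        - ((order y x * ∏ (toList w) (order y)) * (∏ (toList w) (order x) * sign w)) ∎

    sign-repeated : ∀ {m} (w : Vec (Fin n) m) → ¬ AllPairs _≢_ w → sign w ≈ 0#
    sign-repeated []      ¬u = contradiction [] ¬u
    sign-repeated (x ∷ w) ¬u with All.all? (λ y → ¬? (x Fin.≟ y)) w
    ... | yes x≢w = trans (*-congˡ (sign-repeated w (¬u ∘ (x≢w ∷_)))) (zeroʳ _)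
    ... | no ¬x≢w = trans (*-congʳ (∏-order w ¬x≢w)) (zeroˡ _)
      where
      ∏-order : ∀ {m} (w : Vec (Fin n) m) → ¬ All (x ≢_) w → ∏ (toList w) (order x) ≈ 0#
      ∏-order []      ¬a = contradiction [] ¬a
      ∏-order (y ∷ w) ¬a = decide (x Fin.≟ y)
        where
        decide : Dec (x ≡ y) → ∏ (toList (y ∷ w)) (order x) ≈ 0#
        decide (yes ≡.refl) = trans (*-congʳ (reflexive (order-refl x))) (zeroˡ _)
        decide (no x≢y)     = trans (*-congˡ (∏-order w (¬a ∘ (x≢y ∷_)))) (zeroʳ _)

    -- One factor for each pair (i, j) that `τ` filters. The conjunction is the form to which the
    -- decision procedure in `τ` reduces.
    inversionSign : ∀ {m} → Vec (Fin n) m → Fin m → Fin m → Carrier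
    inversionSign w i j =
      if does (i Fin.<? j) ∧ does (lookup w j Fin.<? lookup w i) then - 1# else 1#

    ∏-lookup : ∀ {m} (w : Vec (Fin n) m) f → ∏ (allFin m) (λ i → f (lookup w i)) ≡ ∏ (toList w) f
    ∏-lookup []      f = ≡.refl
    ∏-lookup {suc m} (x ∷ w) f =
      ≡.trans (Prod.⨁-allFin-suc m _) (≡.cong (f x *_) (∏-lookup w f))

    ∏-order-distinct : ∀ {m x} {w : Vec (Fin n) m} → All (x ≢_) w →
      ∏ (toList w) (λ y → if does (y Fin.<? x) then - 1# else 1#) ≡ ∏ (toList w) (order x)
    ∏-order-distinct []          = ≡.refl
    ∏-order-distinct {x = x} {y ∷ w} (x≢y ∷ x≢w)
      rewrite dec-false (x Fin.≟ y) x≢y = ≡.cong (_ *_) (∏-order-distinct x≢w)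

    ∏-inversionSign : ∀ {m} {w : Vec (Fin n) m} → AllPairs _≢_ w →
      (∏[ i ← allFin m ] ∏[ j ← allFin m ] inversionSign w i j) ≈ sign w
    ∏-inversionSign []                            = refl
    ∏-inversionSign {suc m} {x ∷ w} (x≢w ∷ w!) = begin
      (∏[ i ← allFin (suc m) ] ∏[ j ← allFin (suc m) ] inversionSign (x ∷ w) i j)
        ≡⟨ Prod.⨁-allFin-suc m _ ⟩
      (∏[ j ← allFin (suc m) ] inversionSign (x ∷ w) zero j)
        * (∏[ i ← allFin m ] ∏[ j ← allFin (suc m) ] inversionSign (x ∷ w) (suc i) j)
        -- Pairs whose second index is `zero` contribute `1#`, since no index lies below it.
        ≈⟨ *-cong
             (trans (reflexive (Prod.⨁-allFin-suc m _)) (*-identityˡ _))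
             (Prod.⨁-cong (allFin m) λ i →
               trans (reflexive (Prod.⨁-allFin-suc m _)) (*-identityˡ _)) ⟩
      (∏[ j ← allFin m ] (if does (lookup w j Fin.<? x) then - 1# else 1#))
        * (∏[ i ← allFin m ] ∏[ j ← allFin m ] inversionSign w i j)
        ≈⟨ *-cong (reflexive (≡.trans (∏-lookup w _) (∏-order-distinct x≢w)))
                  (∏-inversionSign w!) ⟩
      ∏ (toList w) (order x) * sign w ∎

  -1^length-filter : ∀ {a p} {I : Set a} {P : I → Set p} (P? : Decidable P) xs →
    -1^ length (filter P? xs) ≈ (∏[ x ← xs ] (if does (P? x) then - 1# else 1#))
  -1^length-filter P? [] = refl
  -1^length-filter P? (x ∷ xs) with does (P? x)
  ... | true  = *-congˡ (-1^length-filter P? xs)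
  ... | false = trans (-1^length-filter P? xs) (sym (*-identityˡ _))

  -1^τ≈sign : ∀ {n} {σ : OneLine n} → AllPairs _≢_ σ → -1^ τ σ ≈ sign σ
  -1^τ≈sign {n} {σ} σ! = begin
    -1^ τ σ
      ≈⟨ -1^length-filter _ (cartesianProduct (allFin n) (allFin n)) ⟩
    _
      ≈⟨ Prod.⨁-cartesianProductWith _,_ (allFin n) (allFin n) _ ⟩
    (∏[ i ← allFin n ] ∏[ j ← allFin n ] inversionSign σ i j)
      ≈⟨ ∏-inversionSign σ! ⟩
    sign σ ∎

  ∑-S≈∑-words : ∀ n (g : OneLine n → Carrier) →
    (∑[ σ ← S n ] -1^ τ σ * g σ) ≈ (∑[ w ← words (allFin n) n ] sign w * g w)
  ∑-S≈∑-words n g = trans (Sum.⨁-filter distinct? (words (allFin n) n) _)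
    (Sum.⨁-cong (words (allFin n) n) pointwise)
    where
    distinct? : Decidable (AllPairs (_≢_ {A = Fin n}) {n})
    distinct? = allPairs? λ i j → ¬? (i Fin.≟ j)
    pointwise : ∀ w → (if does (distinct? w) then -1^ τ w * g w else 0#) ≈ sign w * g w
    pointwise w with distinct? w
    ... | yes w! = *-congʳ (-1^τ≈sign w!)
    ... | no ¬w! = sym (trans (*-congʳ (sign-repeated w ¬w!)) (zeroˡ _))

  ∑-upTo-suc : ∀ (f : ℕ → Carrier) n → ∑ (upTo (suc n)) f ≈ ∑ (upTo n) f + f n
  ∑-upTo-suc f n = begin
    ∑ (upTo (suc n)) f             ≡⟨ ≡.cong (λ ks → ∑ ks f) (≡.sym (upTo-∷ʳ n)) ⟩
    ∑ (upTo n ++ n ∷ []) f         ≈⟨ Sum.⨁-++ (upTo n) (n ∷ []) f ⟩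
    ∑ (upTo n) f + (f n + 0#)      ≈⟨ +-congˡ (+-identityʳ (f n)) ⟩
    ∑ (upTo n) f + f n             ∎

  -- The recursion goes in steps of two because `parity` does, and two further factors -1 cancel.
  parity-split : ∀ m x →
    (if does (ℕ.parity m Parity.≟ 0ℙ) then x else 0#)
      - (if does (ℕ.parity m Parity.≟ 1ℙ) then x else 0#) ≈ -1^ m * x
  parity-split zero          x =
    trans (trans (+-congˡ -0#≈0#) (+-identityʳ x)) (sym (*-identityˡ x))
  parity-split (suc zero)    x =
    trans (+-identityˡ _) (sym (trans (*-congʳ (*-identityʳ _)) (-1*x≈-x x)))
  parity-split (suc (suc m)) x = trans (parity-split m x) (*-congʳ (sym
    (trans (-1*x≈-x _) (trans (-‿cong (-1*x≈-x _)) (-‿involutive _)))))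

  -- From polarization to the determinant

  n!det≈∑ : ∀ {n} (A : Matrix n) (γ : OneLine n → Carrier) →
    (n !) ×ℕ det A ≈ (∑[ σ ← S n ] -1^ τ σ * (∑[ k ← upTo (suc n) ]
      (-1^ (n ℕ.∸ k) * combinationSum (λ i → A i (lookup σ i)) k (allFin n) (λ t → (γ σ + t) ^ n))))
  n!det≈∑ {n} A γ = begin
    (n !) ×ℕ det A
      ≈⟨ ×ℕ-* (n !) _ ⟩
    ((n !) ×ℕ 1#) * det A
      ≈⟨ *-distribˡ-∑ _ (S n) _ ⟩
    (∑[ σ ← S n ] ((n !) ×ℕ 1#) * (-1^ τ σ * (∏[ i ← allFin n ] A i (lookup σ i))))
      ≈⟨ Sum.⨁-cong (S n) (λ σ → trans (*-leftComm _ _ _)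
           (*-congˡ (trans (sym (×ℕ-* (n !) _)) (sym (diagonal σ n |allFin|≡n))))) ⟩
    _ ∎
    where
    -- The exponent in `polarization` is `length (allFin n)`, which equals `n` only propositionally.
    -- Abstracting it as `m` allows the equation to be matched with `refl`.
    diagonal : ∀ σ m → length (allFin n) ≡ m → (∑[ k ← upTo (suc m) ]
      (-1^ (m ℕ.∸ k) * combinationSum (λ i → A i (lookup σ i)) k (allFin n) (λ t → (γ σ + t) ^ m)))
      ≈ (m !) ×ℕ (∏[ i ← allFin n ] A i (lookup σ i))
    diagonal σ _ ≡.refl = polarization (λ i → A i (lookup σ i)) (allFin n) (γ σ)

  -- Cancellation of the lower levels and sums over subdiagonals

  module _ (div : WithDivisionByIntegers) where
    open Division div

    -- Injectivity of doubling. The first and last terms of the chain are the unfolded multiples of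
    -- `x` and `0#` by 2.
    x≈-x⇒x≈0 : ∀ x → x ≈ - x → x ≈ 0#
    x≈-x⇒x≈0 x x≈-x = proj₁ (div (+ 2)) (begin
      x + (x + 0#)   ≈⟨ +-congˡ (+-identityʳ x) ⟩
      x + x          ≈⟨ +-congˡ x≈-x ⟩
      x - x          ≈⟨ -‿inverseʳ x ⟩
      0#             ≈⟨ sym (trans (+-identityˡ _) (+-identityˡ _)) ⟩
      0# + (0# + 0#) ∎)

    ≈-1/! : ∀ n {x y} → (n !) ×ℕ x ≈ y → x ≈ 1/ n ! y
    ≈-1/! n {x} {y} n!x≈y = proj₁ (div (+ (n !)) {{n ℕ.!≢0}})
      (trans n!x≈y (sym (proj₂ (proj₂ (div (+ (n !)) {{n ℕ.!≢0}}) y) refl)))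

    module _ {n} (A : Matrix n) (h : Carrier → Carrier) (h-cong : ∀ {x y} → x ≈ y → h x ≈ h y) where

      levelSum : ℕ → Carrier
      levelSum k =
        ∑[ σ ← S n ] -1^ τ σ * combinationSum (λ i → A i (lookup σ i)) k (allFin n) h

      -- A choice of k ≤ n − 2 rows leaves two positions of σ unused, and
      -- exchanging the values there flips the sign.
      levelSum-vanishes : ∀ {k} → 2 ℕ.+ k ℕ.≤ n → levelSum k ≈ 0#
      levelSum-vanishes {k} 2+k≤n = begin
        levelSum k
          ≈⟨ Sum.⨁-cong (S n) (λ σ → *-distribˡ-∑ (-1^ τ σ) (combinations k (allFin n)) _) ⟩
        (∑[ σ ← S n ] ∑[ js ← combinations k (allFin n) ] -1^ τ σ * entry js σ)
          ≈⟨ Sum.⨁-swap (S n) (combinations k (allFin n)) _ ⟩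
        (∑[ js ← combinations k (allFin n) ] ∑[ σ ← S n ] -1^ τ σ * entry js σ)
          ≈⟨ ∑-zero (combinations k (allFin n)) vanishes ⟩
        0# ∎
        where
        entry : List (Fin n) → OneLine n → Carrier
        entry js σ = h (∑[ j ← js ] A j (lookup σ j))

        entry-ignores : ∀ {js i} → i ∉ js → Ignores i (entry js)
        entry-ignores {js} i∉js w x = h-cong (Sum.⨁-cong-∈ js λ {j} j∈js →
          reflexive (≡.cong (A j) (Vec.lookup∘update′ (λ where ≡.refl → i∉js j∈js) w x)))

        vanishes : ∀ {js} → js ∈ combinations k (allFin n) →
          (∑[ σ ← S n ] -1^ τ σ * entry js σ) ≈ 0#
        vanishes {js} js∈ =
          let js⊆ , |js|≡k = combinations⇒⊆ k js∈
              i , j , i≢j , (_ , i∉js) , (_ , j∉js) = ⊆-misses-two js⊆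
                (≡.subst₂ (λ k n → 2 ℕ.+ k ℕ.≤ n) (≡.sym |js|≡k) (≡.sym |allFin|≡n) 2+k≤n)
                (Unique.allFin⁺ n)
          in trans (∑-S≈∑-words n (entry js))
               (∑-alternating-vanishes (allFin n) x≈-x⇒x≈0 i≢j
                 sign-alternating (entry-ignores i∉js) (entry-ignores j∉js))

      ∑-L : ∀ p {k} → n ℕ.≤ suc k → (∑[ l ← L⟨ p ⟩ n k ] h (su A l)) ≈
        (∑[ σ ← S n ] (if does (ℕ.parity (τ σ) Parity.≟ p)
          then combinationSum (λ i → A i (lookup σ i)) k (allFin n) h else 0#))
      ∑-L p {k} n≤1+k = begin
        (∑[ l ← L⟨ p ⟩ n k ] h (su A l))
          ≡⟨ ≡.cong (λ ls → ∑[ l ← ls ] h (su A l)) (L≡concatMap p n≤1+k) ⟩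
        (∑[ l ← concatMap (subdiagonals k) (S⟨ p ⟩ n) ] h (su A l))
          ≈⟨ Sum.⨁-concatMap (subdiagonals k) (S⟨ p ⟩ n) _ ⟩
        (∑[ σ ← S⟨ p ⟩ n ] ∑[ l ← subdiagonals k σ ] h (su A l))
          ≈⟨ Sum.⨁-cong (S⟨ p ⟩ n) on-diagonal ⟩
        (∑[ σ ← S⟨ p ⟩ n ] combinationSum (λ i → A i (lookup σ i)) k (allFin n) h)
          ≈⟨ Sum.⨁-filter (λ σ → ℕ.parity (τ σ) Parity.≟ p) (S n) _ ⟩
        _ ∎
        where
        on-diagonal : ∀ σ → (∑[ l ← subdiagonals k σ ] h (su A l))
          ≈ combinationSum (λ i → A i (lookup σ i)) k (allFin n) h
        on-diagonal σ = trans (reflexive (Sum.⨁-map (map (positions σ)) (combinations k (allFin n)) _))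
          (Sum.⨁-cong (combinations k (allFin n)) λ js →
            h-cong (reflexive (Sum.⨁-map (positions σ) js _)))

      Lᵉ-Lᵒ : ∀ {k} → n ℕ.≤ suc k →
        (∑[ l ← Lᵉ n k ] h (su A l)) - (∑[ l ← Lᵒ n k ] h (su A l)) ≈ levelSum k
      Lᵉ-Lᵒ {k} n≤1+k = begin
        (∑[ l ← Lᵉ n k ] h (su A l)) - (∑[ l ← Lᵒ n k ] h (su A l))
          ≈⟨ +-cong (∑-L 0ℙ n≤1+k) (-‿cong (∑-L 1ℙ n≤1+k)) ⟩
        ∑ (S n) (λ σ → restrict 0ℙ σ) - ∑ (S n) (λ σ → restrict 1ℙ σ)
          ≈⟨ +-congˡ (sym (∑-neg (S n) _)) ⟩
        ∑ (S n) (λ σ → restrict 0ℙ σ) + ∑ (S n) (λ σ → - restrict 1ℙ σ)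
          ≈⟨ sym (Sum.⨁-∙ (S n) _ _) ⟩
        (∑[ σ ← S n ] restrict 0ℙ σ - restrict 1ℙ σ)
          ≈⟨ Sum.⨁-cong (S n) (λ σ → parity-split (τ σ) _) ⟩
        levelSum k ∎
        where
        restrict : Parity → OneLine n → Carrier
        restrict p σ = if does (ℕ.parity (τ σ) Parity.≟ p)
          then combinationSum (λ i → A i (lookup σ i)) k (allFin n) h else 0#

    n!det≈∑L : ∀ n (A : Matrix (suc n)) γ → let N = suc n in
      (N !) ×ℕ det A ≈ - 1# *
        ((((∑[ l ← Lᵉ N n ] ((γ + su A l) ^ N))
           - (∑[ l ← Lᵒ N n ] ((γ + su A l) ^ N)))
           + (∑[ l ← Lᵒ N N ] ((γ + su A l) ^ N)))
           - (∑[ l ← Lᵉ N N ] ((γ + su A l) ^ N)))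
    n!det≈∑L n A γ = begin
      (N !) ×ℕ det A
        ≈⟨ n!det≈∑ A (λ _ → γ) ⟩
      (∑[ σ ← S N ] -1^ τ σ * (∑[ k ← upTo (suc N) ] (-1^ (N ℕ.∸ k) * Q k σ)))
        ≈⟨ Sum.⨁-cong (S N) (λ σ → trans (*-distribˡ-∑ _ (upTo (suc N)) _)
             (Sum.⨁-cong (upTo (suc N)) λ k → *-leftComm _ _ _)) ⟩
      (∑[ σ ← S N ] ∑[ k ← upTo (suc N) ] -1^ (N ℕ.∸ k) * (-1^ τ σ * Q k σ))
        ≈⟨ Sum.⨁-swap (S N) (upTo (suc N)) _ ⟩
      (∑[ k ← upTo (suc N) ] ∑[ σ ← S N ] -1^ (N ℕ.∸ k) * (-1^ τ σ * Q k σ))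
        ≈⟨ Sum.⨁-cong (upTo (suc N)) (λ k → sym (*-distribˡ-∑ _ (S N) _)) ⟩
      (∑[ k ← upTo (suc N) ] level k)
        ≈⟨ ∑-upTo-suc level N ⟩
      (∑[ k ← upTo N ] level k) + level N
        ≈⟨ +-congʳ (∑-upTo-suc level n) ⟩
      ((∑[ k ← upTo n ] level k) + level n) + level N
        ≈⟨ +-cong (trans (+-congʳ (∑-zero (upTo n) λ k∈ → trans
                     (*-congˡ (levelSum-vanishes A h h-cong (ℕ.s≤s (∈-upTo⁻ k∈)))) (zeroʳ _)))
                     (+-identityˡ _))
                  refl ⟩
      level n + level N
        -- The signs (-1)ᴺ⁻ᵏ of the two surviving levels are -1 for k = N - 1 and 1 for k = N,
        -- whatever N is. Taking out -1 reverses the even and odd sums of level N.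
        ≈⟨ +-cong
             (*-cong (reflexive (≡.cong -1^_ (ℕ.m+n∸n≡m 1 n))) (sym (Lᵉ-Lᵒ A h h-cong ℕ.≤-refl)))
             (*-cong (reflexive (≡.cong -1^_ (ℕ.n∸n≡0 N))) (sym (Lᵉ-Lᵒ A h h-cong (ℕ.n≤1+n N)))) ⟩
      -1^ 1 * (e₁ - o₁) + 1# * (e - o)
        ≈⟨ collect e₁ o₁ e o ⟩
      - 1# * (((e₁ - o₁) + o) - e) ∎
      where
      N = suc n
      h : Carrier → Carrier
      h t = (γ + t) ^ N
      h-cong : ∀ {x y} → x ≈ y → h x ≈ h y
      h-cong x≈y = ^-congˡ N (+-congˡ x≈y)
      Q : ℕ → OneLine N → Carrier
      Q k σ = combinationSum (λ i → A i (lookup σ i)) k (allFin N) h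
      level : ℕ → Carrier
      level k = -1^ (N ℕ.∸ k) * levelSum A h h-cong k
      e₁ = ∑[ l ← Lᵉ N n ] h (su A l)
      o₁ = ∑[ l ← Lᵒ N n ] h (su A l)
      e  = ∑[ l ← Lᵉ N N ] h (su A l)
      o  = ∑[ l ← Lᵒ N N ] h (su A l)

      collect : ∀ w x y z → -1^ 1 * (w - x) + 1# * (y - z) ≈ - 1# * (((w - x) + z) - y)
      collect w x y z = begin
        -1^ 1 * (w - x) + 1# * (y - z)
          ≈⟨ +-cong (*-congʳ (*-identityʳ _)) (*-identityˡ _) ⟩
        - 1# * (w - x) + (y - z)
          ≈⟨ +-cong (-1*x≈-x _) (sym (⁻¹-anti-homo‿- z y)) ⟩
        - (w - x) - (z - y)
          ≈⟨ -‿+-comm _ _ ⟩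
        - ((w - x) + (z - y))
          ≈⟨ -‿cong (sym (+-assoc _ _ _)) ⟩
        - (((w - x) + z) - y)
          ≈⟨ sym (-1*x≈-x _) ⟩
        - 1# * (((w - x) + z) - y) ∎

theorem1 :
  ∀ {c ℓ} (K : CommutativeRing c ℓ) →
  let open CommutativeRing K
      open OverRing K in
  (div : WithDivisionByIntegers) →
  let open Division div in
  ∀ (n : ℕ) .{{_ : NonZero n}} (A : Matrix n) →
  (∀ (γ : OneLine n → Carrier) →
    det A ≈ 1/ n ! (∑[ σ ← S n ] (-1^ τ σ *
      (-1^ n * γ σ ^ n
       + (∑[ k ← map suc (upTo n) ]
            (-1^ (n ∸ k) *
              (∑[ js ← combinations k (allFin n) ]
                 ((γ σ + (∑[ j ← js ] A j (lookup σ j))) ^ n))))))))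
  ×
  -- The factor is −1 for every n.  The sign (−1)ⁿ⁻¹ is right only for
  -- even n: for n = 1 the bracket is γ − (γ + a₁₁) = − det A.
  (∀ (γ : Carrier) →
    det A ≈ 1/ n ! (- 1# *
      ((((∑[ l ← Lᵉ n (pred n) ] ((γ + su A l) ^ n))
         - (∑[ l ← Lᵒ n (pred n) ] ((γ + su A l) ^ n)))
         + (∑[ l ← Lᵒ n n ] ((γ + su A l) ^ n)))
         - (∑[ l ← Lᵉ n n ] ((γ + su A l) ^ n)))))
  ×
  (det A ≈ 1/ n ! (- 1# *
      ((((∑[ l ← Lᵉ n (pred n) ] (su A l ^ n))
         - (∑[ l ← Lᵒ n (pred n) ] (su A l ^ n)))
         + (∑[ l ← Lᵒ n n ] (su A l ^ n)))
         - (∑[ l ← Lᵉ n n ] (su A l ^ n)))))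
theorem1 K div n@(suc m) A = free , constant , ≈-1/! div n (trans (n!det≈∑L div m A 0#)
  (*-congˡ (+-cong (+-cong (+-cong (drop-0 (Lᵉ n m)) (-‿cong (drop-0 (Lᵒ n m))))
    (drop-0 (Lᵒ n n))) (-‿cong (drop-0 (Lᵉ n n))))))
  where
  open CommutativeRing K hiding (zero)
  open OverRing K
  open Division div
  open Determinant K
  open Exp semiring using (^-congˡ)

  constant : ∀ γ → det A ≈ 1/ n ! (- 1# *
    ((((∑[ l ← Lᵉ n m ] ((γ + su A l) ^ n))
    - (∑[ l ← Lᵒ n m ] ((γ + su A l) ^ n)))
    + (∑[ l ← Lᵒ n n ] ((γ + su A l) ^ n)))
    - (∑[ l ← Lᵉ n n ] ((γ + su A l) ^ n))))
  constant γ = ≈-1/! div n (n!det≈∑L div m A γ)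

  drop-0 : ∀ ls → (∑[ l ← ls ] ((0# + su A l) ^ n)) ≈ (∑[ l ← ls ] (su A l ^ n))
  drop-0 ls = Sum.⨁-cong ls λ l → ^-congˡ n (+-identityˡ (su A l))

  free : ∀ γ → det A ≈ 1/ n ! (∑[ σ ← S n ] (-1^ τ σ *
    (-1^ n * γ σ ^ n
    + (∑[ k ← map suc (upTo n) ]
    (-1^ (n ∸ k) *
    (∑[ js ← combinations k (allFin n) ]
    ((γ σ + (∑[ j ← js ] A j (lookup σ j))) ^ n)))))))
  free γ = ≈-1/! div n (trans (n!det≈∑ A γ) (Sum.⨁-cong (S n) λ σ → *-congˡ (trans
    (reflexive (≡.cong (λ ks → ∑[ k ← ks ] (-1^ (n ∸ k) *
      (∑[ js ← combinations k (allFin n) ] ((γ σ + (∑[ j ← js ] A j (lookup σ j))) ^ n))))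
      (upTo-suc n)))
    -- The separate γ term is the level k = 0. Its only row choice is empty, so one `0#` comes from
    -- the sum over that choice and one from the end of the outer sum.
    (+-congʳ (*-congˡ (trans (+-identityʳ _) (^-congˡ n (+-identityʳ (γ σ)))))))))
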